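{- Let $a$ and $b$ be positive integers, and let $\zeta$ denote the Riemann zeta function. For each $n\ge 1$ let $q_n$ be the (least) common denominator of the rational elements of the set $\{\zeta(a+b),\zeta(2a+b),\dots,\zeta(an+b)\}$. Then either there are infinitely many $n\in\mathbb{N}$ for which $\zeta(an+b)$ is irrational, or the sequence $\{q_n\}_{n=1}^\infty$ grows super-exponentially, i.e., $q_n^{1/n}\to\infty$ as $n\to\infty$.
   Context: The common denominator $q_n$ is the least positive integer $q$ such that $q\,\zeta(ak+b)\in\mathbb{Z}$ for every $k\in\{1,\dots,n\}$ for which $\zeta(ak+b)$ is rational (so $q_n=1$ if there is no such $k$). "Either ... or" means that at least one of the two alternatives holds. -}

module Defs where

import Algebra.Properties.Group as GroupProperties
open import Data.Integer.Base as ℤ using (ℤ; +_; +≤+)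
import Data.Integer.Properties as ℤ
open import Data.Nat.Base as ℕ using (ℕ; zero; suc; NonZero; NonTrivial; s≤s; z≤n)
import Data.Nat.Properties as ℕ
open import Data.Nat.Tactic.RingSolver using (solve-∀)
open import Data.Product.Base using (_×_; ∃-syntax; Σ-syntax)
open import Data.Rational.Base as ℚ using (ℚ; 0ℚ; _/_; _+_; _-_; -_; _*_; ∣_∣; _≤_;
  _<_)
import Data.Rational.Properties as ℚ
open import Data.Rational.Unnormalised.Base as ℚᵘ using (mkℚᵘ)
import Data.Rational.Unnormalised.Properties as ℚᵘ
open import Data.Sum.Base using (_⊎_; inj₁; inj₂)
open import Relation.Binary.PropositionalEquality
open import Relation.Nullary using (¬_; yes; no; contradiction)

frac-mono : ∀ m d n e .{{_ : NonZero d}} .{{_ : NonZero e}} →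
            m ℕ.* e ℕ.≤ n ℕ.* d → + m / d ≤ + n / e
frac-mono m (suc d) n (suc e) le = ℚ.toℚᵘ-cancel-≤ (begin
  ℚ.toℚᵘ (+ m / suc d)  ≃⟨ ℚ.toℚᵘ-fromℚᵘ (mkℚᵘ (+ m) d) ⟩
  mkℚᵘ (+ m) d          ≤⟨ ℚᵘ.*≤* (subst₂ ℤ._≤_ (ℤ.pos-* m (suc e)) (ℤ.pos-* n (suc d)) (+≤+ le)) ⟩
  mkℚᵘ (+ n) e          ≃⟨ ℚ.toℚᵘ-fromℚᵘ (mkℚᵘ (+ n) e) ⟨
  ℚ.toℚᵘ (+ n / suc e)  ∎)
  where open ℚᵘ.≤-Reasoning

frac-+ : ∀ m d n e .{{_ : NonZero d}} .{{_ : NonZero e}} .{{_ : NonZero (d ℕ.* e)}} →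
         + m / d + + n / e ≡ + (m ℕ.* e ℕ.+ n ℕ.* d) / (d ℕ.* e)
frac-+ m (suc d) n (suc e) = ℚ.toℚᵘ-injective (begin-equality
  ℚ.toℚᵘ (+ m / suc d + + n / suc e)
    ≃⟨ ℚ.toℚᵘ-homo-+ (+ m / suc d) (+ n / suc e) ⟩
  ℚ.toℚᵘ (+ m / suc d) ℚᵘ.+ ℚ.toℚᵘ (+ n / suc e)
    ≃⟨ ℚᵘ.+-cong (ℚ.toℚᵘ-fromℚᵘ (mkℚᵘ (+ m) d)) (ℚ.toℚᵘ-fromℚᵘ (mkℚᵘ (+ n) e)) ⟩
  mkℚᵘ (+ m) d ℚᵘ.+ mkℚᵘ (+ n) e
    ≡⟨ cong (λ z → mkℚᵘ z _) (cong₂ ℤ._+_ (ℤ.pos-* m (suc e)) (ℤ.pos-* n (suc d))) ⟨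
  mkℚᵘ (+ (m ℕ.* suc e ℕ.+ n ℕ.* suc d)) (e ℕ.+ d ℕ.* suc e)
    ≃⟨ ℚ.toℚᵘ-fromℚᵘ (mkℚᵘ (+ (m ℕ.* suc e ℕ.+ n ℕ.* suc d)) (e ℕ.+ d ℕ.* suc e)) ⟨
  ℚ.toℚᵘ (+ (m ℕ.* suc e ℕ.+ n ℕ.* suc d) / (suc d ℕ.* suc e)) ∎)
  where open ℚᵘ.≤-Reasoning

frac-nonNeg : ∀ n d .{{_ : NonZero d}} → 0ℚ ≤ + n / d
frac-nonNeg n d = frac-mono 0 1 n d z≤n

p≤p+frac : ∀ p n d .{{_ : NonZero d}} → p ≤ p + + n / d
p≤p+frac p n d = subst (_≤ p + + n / d) (ℚ.+-identityʳ p) (ℚ.+-monoʳ-≤ p (frac-nonNeg n d))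

-- Real numbers, as regular sequences of rationals in the sense of Bishop:
-- the k-th term (counting from 0) is within 1/(k+1) of the limit.

record ℝ : Set where
  constructor mkℝ
  field
    seq     : ℕ → ℚ
    regular : ∀ k l → ∣ seq k - seq l ∣ ≤ + 1 / suc k + + 1 / suc l

open ℝ public

infix 4 _≈ℝ_ _<ℝ_

_≈ℝ_ : ℝ → ℝ → Set
x ≈ℝ y = ∀ k → ∣ seq x k - seq y k ∣ ≤ + 2 / suc k

-- The slack 2/(k+1) is the total error of the two approximations.
_<ℝ_ : ℝ → ℝ → Set
x <ℝ y = ∃[ k ] seq x k + + 2 / suc k < seq y k

fromℚ : ℚ → ℝ
fromℚ r .seq _ = r
fromℚ r .regular k l = begin
  ∣ r - r ∣                  ≡⟨ cong ∣_∣ (ℚ.+-inverseʳ r) ⟩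
  0ℚ                         ≤⟨ frac-nonNeg 1 (suc k) ⟩
  + 1 / suc k                ≤⟨ p≤p+frac (+ 1 / suc k) 1 (suc l) ⟩
  + 1 / suc k + + 1 / suc l  ∎
  where open ℚ.≤-Reasoning

Irrational : ℝ → Set
Irrational x = ¬ (∃[ r ] x ≈ℝ fromℚ r)

private
  diff≤ : ∀ {p q e} → p ≤ q + e → p - q ≤ e
  diff≤ {p} {q} {e} h = begin
    p - q            ≤⟨ ℚ.+-monoˡ-≤ (- q) h ⟩
    (q + e) - q      ≡⟨ cong (λ z → z - q) (ℚ.+-comm q e) ⟩
    (e + q) - q      ≡⟨ ℚ.+-assoc e q (- q) ⟩
    e + (q - q)      ≡⟨ cong (λ z → e + z) (ℚ.+-inverseʳ q) ⟩
    e + 0ℚ           ≡⟨ ℚ.+-identityʳ e ⟩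
    e                ∎
    where open ℚ.≤-Reasoning

  -[p-q]≡q-p : ∀ p q → - (p - q) ≡ q - p
  -[p-q]≡q-p p q = ⁻¹-anti-homo-// p q
    where open GroupProperties ℚ.+-0-group using (⁻¹-anti-homo-//)

fromOneSided : (x : ℕ → ℚ) → (∀ k l → x k ≤ x l + + 1 / suc l) → ℝ
fromOneSided x h .seq = x
fromOneSided x h .regular k l with ℚ.∣p∣≡p∨∣p∣≡-p (x k - x l)
... | inj₁ eq = begin
  ∣ x k - x l ∣              ≡⟨ eq ⟩
  x k - x l                  ≤⟨ diff≤ (h k l) ⟩
  + 1 / suc l                ≤⟨ p≤p+frac (+ 1 / suc l) 1 (suc k) ⟩
  + 1 / suc l + + 1 / suc k  ≡⟨ ℚ.+-comm (+ 1 / suc l) (+ 1 / suc k) ⟩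
  + 1 / suc k + + 1 / suc l  ∎
  where open ℚ.≤-Reasoning
... | inj₂ eq = begin
  ∣ x k - x l ∣              ≡⟨ eq ⟩
  - (x k - x l)              ≡⟨ -[p-q]≡q-p (x k) (x l) ⟩
  x l - x k                  ≤⟨ diff≤ (h l k) ⟩
  + 1 / suc k                ≤⟨ p≤p+frac (+ 1 / suc k) 1 (suc l) ⟩
  + 1 / suc k + + 1 / suc l  ∎
  where open ℚ.≤-Reasoning

1/_^_ : (m s : ℕ) .{{_ : NonZero m}} → ℚ
1/ m ^ s = (+ 1 / (m ℕ.^ s)) {{ℕ.m^n≢0 m s}}

-- Σ_{m=1}^{N} 1/m^s
partialSum : ℕ → ℕ → ℚ
partialSum s zero    = 0ℚ
partialSum s (suc N) = partialSum s N + 1/ suc N ^ s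

private
  -- 1/(m+1)^s ≤ 1/m − 1/(m+1)
  tail-step : ∀ s .{{_ : NonTrivial s}} m .{{_ : NonZero m}} →
              1/ suc m ^ s + + 1 / suc m ≤ + 1 / m
  tail-step (suc (suc s)) m@(suc m-1) = begin
    1/ suc m ^ suc (suc s) + + 1 / suc m
      ≤⟨ ℚ.+-monoˡ-≤ (+ 1 / suc m)
           (frac-mono 1 (suc m ℕ.^ suc (suc s)) 1 (m ℕ.* suc m) {{ℕ.m^n≢0 (suc m) (suc (suc s))}}
             (subst₂ ℕ._≤_ (sym (ℕ.*-identityˡ (m ℕ.* suc m)))
                           (sym (ℕ.*-identityˡ (suc m ℕ.^ suc (suc s)))) square≤)) ⟩
    + 1 / (m ℕ.* suc m) + + 1 / suc m
      ≡⟨ frac-+ 1 (m ℕ.* suc m) 1 (suc m) ⟩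
    + (1 ℕ.* suc m ℕ.+ 1 ℕ.* (m ℕ.* suc m)) / (m ℕ.* suc m ℕ.* suc m)
      ≤⟨ frac-mono (1 ℕ.* suc m ℕ.+ 1 ℕ.* (m ℕ.* suc m)) (m ℕ.* suc m ℕ.* suc m) 1 m
           (ℕ.≤-reflexive (identity m)) ⟩
    + 1 / m ∎
    where
    open ℚ.≤-Reasoning
    square≤ : m ℕ.* suc m ℕ.≤ suc m ℕ.* (suc m ℕ.* suc m ℕ.^ s)
    square≤ = ℕ.*-mono-≤ (ℕ.n≤1+n m) (ℕ.m≤m*n (suc m) (suc m ℕ.^ s) {{ℕ.m^n≢0 (suc m) s}})
    identity : ∀ m → (1 ℕ.* suc m ℕ.+ 1 ℕ.* (m ℕ.* suc m)) ℕ.* m ≡ 1 ℕ.* (m ℕ.* suc m ℕ.* suc m)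
    identity = solve-∀

  partialSum-mono : ∀ s {M N} → M ℕ.≤′ N → partialSum s M ≤ partialSum s N
  partialSum-mono s ℕ.≤′-refl = ℚ.≤-refl
  partialSum-mono s (ℕ.≤′-step {N} M≤N) = ℚ.≤-trans (partialSum-mono s M≤N)
    (p≤p+frac (partialSum s N) 1 (suc N ℕ.^ s) {{ℕ.m^n≢0 (suc N) s}})

  tail-bound : ∀ s .{{_ : NonTrivial s}} {l k} → l ℕ.≤′ k →
               partialSum s (suc k) + + 1 / suc k ≤ partialSum s (suc l) + + 1 / suc l
  tail-bound s ℕ.≤′-refl = ℚ.≤-refl
  tail-bound s {l} (ℕ.≤′-step {k} l≤k) = begin
    (partialSum s (suc k) + 1/ suc (suc k) ^ s) + + 1 / suc (suc k)
      ≡⟨ ℚ.+-assoc (partialSum s (suc k)) (1/ suc (suc k) ^ s) (+ 1 / suc (suc k)) ⟩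
    partialSum s (suc k) + (1/ suc (suc k) ^ s + + 1 / suc (suc k))
      ≤⟨ ℚ.+-monoʳ-≤ (partialSum s (suc k)) (tail-step s (suc k)) ⟩
    partialSum s (suc k) + + 1 / suc k
      ≤⟨ tail-bound s l≤k ⟩
    partialSum s (suc l) + + 1 / suc l ∎
    where open ℚ.≤-Reasoning

  partialSum-oneSided : ∀ s .{{_ : NonTrivial s}} k l →
                        partialSum s (suc k) ≤ partialSum s (suc l) + + 1 / suc l
  partialSum-oneSided s k l with ℕ.≤-total k l
  ... | inj₁ k≤l = ℚ.≤-trans (partialSum-mono s (ℕ.≤⇒≤′ (s≤s k≤l)))
                             (p≤p+frac (partialSum s (suc l)) 1 (suc l))
  ... | inj₂ l≤k = ℚ.≤-trans (p≤p+frac (partialSum s (suc k)) 1 (suc k))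
                             (tail-bound s (ℕ.≤⇒≤′ l≤k))

-- Only the values at integers s ≥ 2 are needed; there ζ is the sum of its
-- Dirichlet series, and the first k+1 terms leave a tail of at most 1/(k+1).
ζ : (s : ℕ) .{{_ : NonTrivial s}} → ℝ
ζ s = fromOneSided (λ k → partialSum s (suc k)) (partialSum-oneSided s)

ak+b-nonTrivial : ∀ a b k .{{_ : NonZero a}} .{{_ : NonZero b}} .{{_ : NonZero k}} →
                  NonTrivial (a ℕ.* k ℕ.+ b)
ak+b-nonTrivial a b k = ℕ.n>1⇒nonTrivial
  (ℕ.+-mono-≤ (ℕ.>-nonZero⁻¹ (a ℕ.* k) {{ℕ.m*n≢0 a k}}) (ℕ.>-nonZero⁻¹ b))

ζ[ak+b] : ∀ a b k .{{_ : NonZero a}} .{{_ : NonZero b}} .{{k≢0 : NonZero k}} → ℝ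
ζ[ak+b] a b k = ζ (a ℕ.* k ℕ.+ b) {{ak+b-nonTrivial a b k}}

-- The largest j ≤ bound with j ^ n ≤ q (and 0 if there is none).
rootSearch : (n q bound : ℕ) → ℕ
rootSearch n q zero    = 0
rootSearch n q (suc j) with suc j ℕ.^ n ℕ.≤? q
... | yes _ = suc j
... | no  _ = rootSearch n q j

⌊root⌋ : (n q : ℕ) → ℕ
⌊root⌋ n q = rootSearch n q q

private
  rootSearch-lower : ∀ n .{{_ : NonZero n}} q B → rootSearch n q B ℕ.^ n ℕ.≤ q
  rootSearch-lower (suc n) q zero = z≤n
  rootSearch-lower n q (suc j) with suc j ℕ.^ n ℕ.≤? q
  ... | yes le = le
  ... | no  _  = rootSearch-lower n q j

  rootSearch-upper : ∀ n q B → q ℕ.< suc B ℕ.^ n → q ℕ.< suc (rootSearch n q B) ℕ.^ n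
  rootSearch-upper n q zero    h = h
  rootSearch-upper n q (suc j) h with suc j ℕ.^ n ℕ.≤? q
  ... | yes _  = h
  ... | no  ≰  = rootSearch-upper n q j (ℕ.≰⇒> ≰)

⌊root⌋-lower : ∀ n .{{_ : NonZero n}} q → ⌊root⌋ n q ℕ.^ n ℕ.≤ q
⌊root⌋-lower n q = rootSearch-lower n q q

⌊root⌋-upper : ∀ n .{{_ : NonZero n}} q → q ℕ.< suc (⌊root⌋ n q) ℕ.^ n
⌊root⌋-upper n@(suc n-1) q =
  rootSearch-upper n q q (ℕ.m≤m*n (suc q) (suc q ℕ.^ n-1) {{ℕ.m^n≢0 (suc q) n-1}})

private
  ^-cancel-< : ∀ n {x y} → x ℕ.^ n ℕ.< y ℕ.^ n → x ℕ.< y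
  ^-cancel-< n {x} {y} h with x ℕ.<? y
  ... | yes p = p
  ... | no ≮  = contradiction (ℕ.^-monoˡ-≤ n (ℕ.≮⇒≥ ≮)) (ℕ.<⇒≱ h)

  ^-distrib-* : ∀ n x y → (x ℕ.* y) ℕ.^ n ≡ x ℕ.^ n ℕ.* y ℕ.^ n
  ^-distrib-* zero    x y = refl
  ^-distrib-* (suc n) x y = trans (cong (x ℕ.* y ℕ.*_) (^-distrib-* n x y))
                                  (interchange x y (x ℕ.^ n) (y ℕ.^ n))
    where
    interchange : ∀ a b c d → a ℕ.* b ℕ.* (c ℕ.* d) ≡ a ℕ.* c ℕ.* (b ℕ.* d)
    interchange = solve-∀

-- ⌊(q K^n)^{1/n}⌋ / K with K = k+1, hence within 1/K below q^{1/n}.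
root-seq : (n q k : ℕ) → ℚ
root-seq n q k = + ⌊root⌋ n (q ℕ.* suc k ℕ.^ n) / suc k

private
  root-oneSided : ∀ n .{{_ : NonZero n}} q k l → root-seq n q k ≤ root-seq n q l + + 1 / suc l
  root-oneSided n q k l = begin
    + i / K
      ≤⟨ frac-mono i K (j ℕ.* L ℕ.+ 1 ℕ.* L) (L ℕ.* L)
           (subst₂ ℕ._≤_ (ℕ.*-assoc i L L) (rearrange j L K) (ℕ.*-monoˡ-≤ L (ℕ.<⇒≤ cross))) ⟩
    + (j ℕ.* L ℕ.+ 1 ℕ.* L) / (L ℕ.* L)
      ≡⟨ frac-+ j L 1 L ⟨
    + j / L + + 1 / L ∎
    where
    K = suc k
    L = suc l
    i = ⌊root⌋ n (q ℕ.* K ℕ.^ n)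
    j = ⌊root⌋ n (q ℕ.* L ℕ.^ n)
    rearrange : ∀ j L K → suc j ℕ.* K ℕ.* L ≡ (j ℕ.* L ℕ.+ 1 ℕ.* L) ℕ.* K
    rearrange = solve-∀
    swap : ∀ x y z → x ℕ.* y ℕ.* z ≡ x ℕ.* z ℕ.* y
    swap = solve-∀
    cross : i ℕ.* L ℕ.< suc j ℕ.* K
    cross = ^-cancel-< n (begin-strict
      (i ℕ.* L) ℕ.^ n                 ≡⟨ ^-distrib-* n i L ⟩
      i ℕ.^ n ℕ.* L ℕ.^ n             ≤⟨ ℕ.*-monoˡ-≤ (L ℕ.^ n) (⌊root⌋-lower n (q ℕ.* K ℕ.^ n)) ⟩
      q ℕ.* K ℕ.^ n ℕ.* L ℕ.^ n       ≡⟨ swap q (K ℕ.^ n) (L ℕ.^ n) ⟩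
      q ℕ.* L ℕ.^ n ℕ.* K ℕ.^ n       <⟨ ℕ.*-monoˡ-< (K ℕ.^ n) {{ℕ.m^n≢0 K n}} (⌊root⌋-upper n (q ℕ.* L ℕ.^ n)) ⟩
      suc j ℕ.^ n ℕ.* K ℕ.^ n         ≡⟨ ^-distrib-* n (suc j) K ⟨
      (suc j ℕ.* K) ℕ.^ n             ∎)
      where open ℕ.≤-Reasoning
    open ℚ.≤-Reasoning

root : (n : ℕ) .{{_ : NonZero n}} → ℕ → ℝ
root n q = fromOneSided (root-seq n q) (root-oneSided n q)

IsInteger : ℚ → Set
IsInteger r = ∃[ z ] r ≡ z / 1

module _ (a b : ℕ) .{{_ : NonZero a}} .{{_ : NonZero b}} where

  IsCommonDenominator : ℕ → ℕ → Set
  IsCommonDenominator n q =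
    NonZero q ×
    (∀ k .{{_ : NonZero k}} → k ℕ.≤ n →
     ∀ r → ζ[ak+b] a b k ≈ℝ fromℚ r → IsInteger (+ q / 1 * r))

  IsLeastCommonDenominator : ℕ → ℕ → Set
  IsLeastCommonDenominator n q =
    IsCommonDenominator n q × (∀ q′ → IsCommonDenominator n q′ → q ℕ.≤ q′)

  InfinitelyManyIrrational : Set
  InfinitelyManyIrrational =
    ∀ N → ∃[ n ] Σ[ n≢0 ∈ NonZero n ] N ℕ.≤ n × Irrational (ζ[ak+b] a b n {{k≢0 = n≢0}})

TendsToInfinity : ((n : ℕ) .{{_ : NonZero n}} → ℝ) → Set
TendsToInfinity x = ∀ C → ∃[ N ] (∀ n .{{_ : NonZero n}} → N ℕ.≤ n → C <ℝ x n)

-- q_n^{1/n} → ∞; the value q 0 plays no role.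
GrowsSuperExponentially : (ℕ → ℕ) → Set
GrowsSuperExponentially q = TendsToInfinity (λ n → root n (q n))

{-# OPTIONS --safe #-}
-- Let w(x) = ∏_{i=1}^{M} (1 - i^a x).  Replacing x^k by ζ(ak+b) in x^j w(x) gives an
-- integral combination of ζ(aj+b), …, ζ(a(j+M)+b) equal to Σ_m m^{-(aj+b)} w(m^{-a}).
-- The terms m ≤ M vanish and the others lie in (0, m^{-(aj+b)}], so the combination is
-- positive and at most (M+1)^{-j}.  If all these values are rational, multiplying by
-- q_n with n = j + M gives a positive integer, whence q_n ≥ (M+1)^{n-M}; M is arbitrary.
module Submission where

open import Defs
open import Axiom.ExcludedMiddle using (ExcludedMiddle)
open import Data.Integer.Base as ℤ using (+_; -[1+_])
import Data.Integer.Properties as ℤ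
open import Data.Nat.Base as ℕ using (ℕ; zero; suc; NonZero; s≤s; z≤n)
import Data.Nat.Properties as ℕ
open import Data.Nat.Tactic.RingSolver using (solve-∀)
open import Data.Product.Base using (_×_; _,_; proj₁; proj₂; ∃-syntax; Σ-syntax)
open import Data.Rational.Base as ℚ using (ℚ; mkℚ; 0ℚ; 1ℚ; _/_; _+_; _-_; -_; _*_; ∣_∣;
  _≤_; _<_; Positive)
import Data.Rational.Properties as ℚ
open import Data.Rational.Solver using (module +-*-Solver)
open import Data.Rational.Unnormalised.Base as ℚᵘ using (mkℚᵘ)
import Data.Rational.Unnormalised.Properties as ℚᵘ
open import Data.Sum.Base using (_⊎_; inj₁; inj₂)
open import Level using (0ℓ)
open import Relation.Binary.PropositionalEquality
open import Relation.Nullary using (yes; no; contradiction)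

open +-*-Solver using (solve; _:+_; _:*_; _:-_; :-_; _:=_; con)

-- Arithmetic of fractions with natural numerators.

frac-mono-< : ∀ m d n e .{{_ : NonZero d}} .{{_ : NonZero e}} →
              m ℕ.* e ℕ.< n ℕ.* d → + m / d < + n / e
frac-mono-< m (suc d) n (suc e) lt = ℚ.toℚᵘ-cancel-< (begin-strict
  ℚ.toℚᵘ (+ m / suc d)  ≃⟨ ℚ.toℚᵘ-fromℚᵘ (mkℚᵘ (+ m) d) ⟩
  mkℚᵘ (+ m) d          <⟨ ℚᵘ.*<* (subst₂ ℤ._<_ (ℤ.pos-* m (suc e)) (ℤ.pos-* n (suc d)) (ℤ.+<+ lt)) ⟩
  mkℚᵘ (+ n) e          ≃⟨ ℚ.toℚᵘ-fromℚᵘ (mkℚᵘ (+ n) e) ⟨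
  ℚ.toℚᵘ (+ n / suc e)  ∎)
  where open ℚᵘ.≤-Reasoning

frac-≡ : ∀ m d n e .{{_ : NonZero d}} .{{_ : NonZero e}} →
         m ℕ.* e ≡ n ℕ.* d → + m / d ≡ + n / e
frac-≡ m d n e eq = ℚ.≤-antisym (frac-mono m d n e (ℕ.≤-reflexive eq))
                                (frac-mono n e m d (ℕ.≤-reflexive (sym eq)))

frac-* : ∀ m d n e .{{_ : NonZero d}} .{{_ : NonZero e}} .{{_ : NonZero (d ℕ.* e)}} →
         (+ m / d) * (+ n / e) ≡ + (m ℕ.* n) / (d ℕ.* e)
frac-* m (suc d) n (suc e) = ℚ.toℚᵘ-injective (begin-equality
  ℚ.toℚᵘ ((+ m / suc d) * (+ n / suc e))
    ≃⟨ ℚ.toℚᵘ-homo-* (+ m / suc d) (+ n / suc e) ⟩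
  ℚ.toℚᵘ (+ m / suc d) ℚᵘ.* ℚ.toℚᵘ (+ n / suc e)
    ≃⟨ ℚᵘ.*-cong (ℚ.toℚᵘ-fromℚᵘ (mkℚᵘ (+ m) d)) (ℚ.toℚᵘ-fromℚᵘ (mkℚᵘ (+ n) e)) ⟩
  mkℚᵘ (+ m) d ℚᵘ.* mkℚᵘ (+ n) e
    ≡⟨ cong (λ z → mkℚᵘ z (e ℕ.+ d ℕ.* suc e)) (ℤ.pos-* m n) ⟨
  mkℚᵘ (+ (m ℕ.* n)) (e ℕ.+ d ℕ.* suc e)
    ≃⟨ ℚ.toℚᵘ-fromℚᵘ (mkℚᵘ (+ (m ℕ.* n)) (e ℕ.+ d ℕ.* suc e)) ⟨
  ℚ.toℚᵘ (+ (m ℕ.* n) / (suc d ℕ.* suc e)) ∎)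
  where open ℚᵘ.≤-Reasoning

frac-cancel-1≤ : ∀ n d .{{_ : NonZero d}} → 1ℚ ≤ + n / d → d ℕ.≤ n
frac-cancel-1≤ n d 1≤n/d with d ℕ.≤? n
... | yes d≤n = d≤n
... | no  d≰n = contradiction
  (ℚ.<-≤-trans (frac-mono-< n d 1 1 (subst₂ ℕ._<_ (sym (ℕ.*-identityʳ n)) (sym (ℕ.*-identityˡ d))
                                       (ℕ.≰⇒> d≰n))) 1≤n/d)
  (ℚ.<-irrefl refl)

1/^-+ : ∀ m s t .{{_ : NonZero m}} → 1/ m ^ (s ℕ.+ t) ≡ 1/ m ^ s * 1/ m ^ t
1/^-+ m s t = sym (trans (frac-* 1 (m ℕ.^ s) 1 (m ℕ.^ t))
  (frac-≡ 1 (m ℕ.^ s ℕ.* m ℕ.^ t) 1 (m ℕ.^ (s ℕ.+ t))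
     (cong (1 ℕ.*_) (ℕ.^-distribˡ-+-* m s t))))
  where
  instance
    _ = ℕ.m^n≢0 m s
    _ = ℕ.m^n≢0 m t
    _ = ℕ.m^n≢0 m (s ℕ.+ t)
    _ = ℕ.m*n≢0 (m ℕ.^ s) (m ℕ.^ t)

1/^-pos : ∀ m s .{{_ : NonZero m}} → Positive (1/ m ^ s)
1/^-pos m s = ℚ.normalize-pos 1 (m ℕ.^ s) {{ℕ.m^n≢0 m s}}

p-q≤r⇒p≤q+r : ∀ p q {r} → p - q ≤ r → p ≤ q + r
p-q≤r⇒p≤q+r p q {r} h = begin
  p             ≡⟨ solve 2 (λ p q → p := q :+ (p :- q)) refl p q ⟩
  q + (p - q)   ≤⟨ ℚ.+-monoʳ-≤ q h ⟩
  q + r         ∎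
  where open ℚ.≤-Reasoning

p≤∣p∣ : ∀ p → p ≤ ∣ p ∣
p≤∣p∣ p@(mkℚ (+ _) _ _)    = ℚ.≤-refl
p≤∣p∣ p@(mkℚ -[1+ _ ] _ _) = ℚ.≤-trans (ℚ.nonPositive⁻¹ p) (ℚ.0≤∣p∣ p)

p<q⇒0<q-p : ∀ {p q} → p < q → 0ℚ < q - p
p<q⇒0<q-p {p} {q} p<q = subst (_< q - p) (ℚ.+-inverseʳ p) (ℚ.+-monoˡ-< (- p) p<q)

<-natural : ∀ p → ∃[ n ] p < + n / 1
<-natural p@(mkℚ -[1+ _ ] _ _) = 0 , ℚ.negative⁻¹ p
<-natural p@(mkℚ (+ n) d _)    = suc n , (begin-strict
  p            ≡⟨ ℚ.↥p/↧p≡p p ⟨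
  + n / suc d  <⟨ frac-mono-< n (suc d) (suc n) 1
                    (subst (ℕ._< suc n ℕ.* suc d) (sym (ℕ.*-identityʳ n)) (ℕ.m≤m*n (suc n) (suc d))) ⟩
  + suc n / 1  ∎)
  where open ℚ.≤-Reasoning

-- The numerator of a positive fraction is at least 1, so its own denominator serves.
positive-≥-unit-fraction : ∀ p → 0ℚ < p → ∃[ d ] + 1 / suc d ≤ p
positive-≥-unit-fraction p@(mkℚ (+ suc n) d _) _ = d , (begin
  + 1 / suc d      ≤⟨ frac-mono 1 (suc d) (suc n) (suc d) (ℕ.*-monoˡ-≤ (suc d) (s≤s (z≤n {n}))) ⟩
  + suc n / suc d  ≡⟨ ℚ.↥p/↧p≡p p ⟩
  p                ∎)
  where open ℚ.≤-Reasoning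
positive-≥-unit-fraction p@(mkℚ (+ zero) _ _) 0<p =
  contradiction (ℚ.<-≤-trans 0<p (ℚ.nonPositive⁻¹ p)) (ℚ.<-irrefl refl)
positive-≥-unit-fraction p@(mkℚ -[1+ _ ] _ _) 0<p =
  contradiction (ℚ.<-trans 0<p (ℚ.negative⁻¹ p)) (ℚ.<-irrefl refl)

-- Rational limits with an explicit rate.

ε : ℕ → ℚ
ε k = + 1 / suc k

-- If `p` exceeded `q`, the gap would be at least some `1/(d+1)`, while the error `A * ε k` drops
-- below that for large `k`.
≤-by-approximation : ∀ {p q} A K → (∀ k → K ℕ.≤ k → p ≤ q + A * ε k) → p ≤ q
≤-by-approximation {p} {q} A K h with p ℚ.≤? q
... | yes p≤q = p≤q
... | no  p≰q = contradiction (begin-strict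
    p                   ≤⟨ h k (ℕ.m≤m+n K (n ℕ.* suc d)) ⟩
    q + A * ε k         ≤⟨ ℚ.+-monoʳ-≤ q (ℚ.*-monoʳ-≤-nonNeg (ε k) {{ℚ.normalize-nonNeg 1 (suc k)}}
                                            (ℚ.<⇒≤ A<n)) ⟩
    q + (+ n / 1) * ε k ≡⟨ cong (λ z → q + z) (frac-* n 1 1 (suc k)) ⟩
    q + + (n ℕ.* 1) / (1 ℕ.* suc k)
                        <⟨ ℚ.+-monoʳ-< q (frac-mono-< (n ℕ.* 1) (1 ℕ.* suc k) 1 (suc d) n*d<k) ⟩
    q + + 1 / suc d     ≤⟨ ℚ.+-monoʳ-≤ q d≤p-q ⟩
    q + (p - q)         ≡⟨ solve 2 (λ p q → q :+ (p :- q) := p) refl p q ⟩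
    p                   ∎) (ℚ.<-irrefl refl)
  where
  open ℚ.≤-Reasoning
  n = proj₁ (<-natural A)
  A<n = proj₂ (<-natural A)
  unit = positive-≥-unit-fraction (p - q) (p<q⇒0<q-p (ℚ.≰⇒> p≰q))
  d = proj₁ unit
  d≤p-q = proj₂ unit
  -- With `A < n`, this index is at least `K` and satisfies `n(d+1) < k+1`, so `A * ε k` is less
  -- than `1/(d+1)`.
  k = K ℕ.+ n ℕ.* suc d
  n*d<k : n ℕ.* 1 ℕ.* suc d ℕ.< 1 ℕ.* (1 ℕ.* suc k)
  n*d<k = subst₂ ℕ._<_ (cong (ℕ._* suc d) (sym (ℕ.*-identityʳ n)))
            (sym (trans (ℕ.*-identityˡ (1 ℕ.* suc k)) (ℕ.*-identityˡ (suc k))))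
            (s≤s (ℕ.m≤n+m (n ℕ.* suc d) K))

-- The constant `A` is left free so that the notion is closed under linear combinations; the fixed
-- constant 2 of `_≈ℝ_` would not be.
Converges : (ℕ → ℚ) → ℚ → Set
Converges x r = ∃[ A ] (∀ k → ∣ x k - r ∣ ≤ A * ε k)

-- The bound is asked only from `K` on, because the estimates for the partial combinations start at
-- `M`.
converges-upper : ∀ {x r u} K → Converges x r → (∀ k → K ℕ.≤ k → x k ≤ u) → r ≤ u
converges-upper {x} {r} {u} K (A , h) x≤u = ≤-by-approximation A K λ k K≤k → begin
  r                ≤⟨ p-q≤r⇒p≤q+r r (x k) (begin
      r - x k        ≤⟨ p≤∣p∣ (r - x k) ⟩
      ∣ r - x k ∣    ≡⟨ cong ∣_∣ (solve 2 (λ r x → r :- x := :- (x :- r)) refl r (x k)) ⟩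
      ∣ - (x k - r) ∣ ≡⟨ ℚ.∣-p∣≡∣p∣ (x k - r) ⟩
      ∣ x k - r ∣    ≤⟨ h k ⟩
      A * ε k        ∎) ⟩
  x k + A * ε k    ≤⟨ ℚ.+-monoˡ-≤ (A * ε k) (x≤u k K≤k) ⟩
  u + A * ε k      ∎
  where open ℚ.≤-Reasoning

converges-lower : ∀ {x r u} K → Converges x r → (∀ k → K ℕ.≤ k → u ≤ x k) → u ≤ r
converges-lower {x} {r} {u} K (A , h) u≤x = ≤-by-approximation A K λ k K≤k →
  ℚ.≤-trans (u≤x k K≤k) (p-q≤r⇒p≤q+r (x k) r (ℚ.≤-trans (p≤∣p∣ (x k - r)) (h k)))

-- This is one step of the recursion defining `Δ`; by the triangle inequality the rates combine to
-- `A + ∣ c ∣ * B`.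
converges-sub-scaled : ∀ {x y r s} c → Converges x r → Converges y s →
                       Converges (λ k → x k - c * y k) (r - c * s)
converges-sub-scaled {x} {y} {r} {s} c (A , h) (B , g) = A + ∣ c ∣ * B , λ k → begin
  ∣ (x k - c * y k) - (r - c * s) ∣
    ≡⟨ cong ∣_∣ (solve 5 (λ x y r s c → (x :- c :* y) :- (r :- c :* s) := (x :- r) :- c :* (y :- s))
                  refl (x k) (y k) r s c) ⟩
  ∣ (x k - r) - c * (y k - s) ∣
    ≤⟨ ℚ.∣p-q∣≤∣p∣+∣q∣ (x k - r) (c * (y k - s)) ⟩
  ∣ x k - r ∣ + ∣ c * (y k - s) ∣
    ≡⟨ cong (λ z → ∣ x k - r ∣ + z) (ℚ.∣p*q∣≡∣p∣*∣q∣ c (y k - s)) ⟩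
  ∣ x k - r ∣ + ∣ c ∣ * ∣ y k - s ∣
    ≤⟨ ℚ.+-mono-≤ (h k) (ℚ.*-monoˡ-≤-nonNeg ∣ c ∣ {{ℚ.∣-∣-nonNeg c}} (g k)) ⟩
  A * ε k + ∣ c ∣ * (B * ε k)
    ≡⟨ solve 4 (λ A c B e → A :* e :+ c :* (B :* e) := (A :+ c :* B) :* e) refl A ∣ c ∣ B (ε k) ⟩
  (A + ∣ c ∣ * B) * ε k ∎
  where open ℚ.≤-Reasoning

-- Integrality and a telescoping estimate.

isInteger-sub-scaled : ∀ {p q} n → IsInteger p → IsInteger q → IsInteger (p - (+ n / 1) * q)
isInteger-sub-scaled {p} {q} n (z , refl) (w , refl) = z ℤ.- + n ℤ.* w , ℚ.toℚᵘ-injective (begin-equality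
  ℚ.toℚᵘ (z / 1 - (+ n / 1) * (w / 1))
    ≃⟨ ℚ.toℚᵘ-homo-+ (z / 1) (- ((+ n / 1) * (w / 1))) ⟩
  ℚ.toℚᵘ (z / 1) ℚᵘ.+ ℚ.toℚᵘ (- ((+ n / 1) * (w / 1)))
    ≃⟨ ℚᵘ.+-cong (embed z) (ℚᵘ.≃-trans (ℚ.toℚᵘ-homo‿- ((+ n / 1) * (w / 1)))
         (ℚᵘ.-‿cong (ℚᵘ.≃-trans (ℚ.toℚᵘ-homo-* (+ n / 1) (w / 1))
                                (ℚᵘ.*-cong (embed (+ n)) (embed w))))) ⟩
  mkℚᵘ z 0 ℚᵘ.- mkℚᵘ (+ n) 0 ℚᵘ.* mkℚᵘ w 0
    ≡⟨ cong (λ v → mkℚᵘ v 0) (cong₂ ℤ._+_ (ℤ.*-identityʳ z) (ℤ.*-identityʳ (ℤ.- (+ n ℤ.* w)))) ⟩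
  mkℚᵘ (z ℤ.- + n ℤ.* w) 0
    ≃⟨ embed (z ℤ.- + n ℤ.* w) ⟨
  ℚ.toℚᵘ ((z ℤ.- + n ℤ.* w) / 1) ∎)
  where
  open ℚᵘ.≤-Reasoning
  embed : ∀ v → ℚ.toℚᵘ (v / 1) ℚᵘ.≃ mkℚᵘ v 0
  embed v = ℚ.toℚᵘ-fromℚᵘ (mkℚᵘ v 0)

positive-integer-≥1 : ∀ {p} → IsInteger p → 0ℚ < p → 1ℚ ≤ p
positive-integer-≥1 (+ zero , refl)  0<p = contradiction 0<p (ℚ.<-irrefl refl)
positive-integer-≥1 (+ suc n , refl) 0<p = frac-mono 1 1 (suc n) 1 (s≤s z≤n)
positive-integer-≥1 (-[1+ n ] , refl) 0<p = contradiction
  (ℚ.<-≤-trans 0<p (ℚ.neg-antimono-≤ (frac-nonNeg (suc n) 1))) (ℚ.<-irrefl refl)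

-- The bound telescopes over n to Σ_{n≥N} 1/e_n ≤ 1/(C N).
telescoping-step : ∀ C n e .{{_ : NonZero C}} .{{_ : NonZero n}} .{{_ : NonZero e}}
                   .{{_ : NonZero (C ℕ.* suc n)}} .{{_ : NonZero (C ℕ.* n)}} →
                   C ℕ.* (n ℕ.* suc n) ℕ.≤ e →
                   + 1 / e + + 1 / (C ℕ.* suc n) ≤ + 1 / (C ℕ.* n)
telescoping-step C n e h = begin
  + 1 / e + + 1 / (C ℕ.* suc n)
    ≤⟨ ℚ.+-monoˡ-≤ (+ 1 / (C ℕ.* suc n)) (frac-mono 1 e 1 d (ℕ.*-monoʳ-≤ 1 h)) ⟩
  + 1 / d + + 1 / (C ℕ.* suc n)
    ≡⟨ frac-+ 1 d 1 (C ℕ.* suc n) ⟩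
  + (1 ℕ.* (C ℕ.* suc n) ℕ.+ 1 ℕ.* d) / (d ℕ.* (C ℕ.* suc n))
    ≡⟨ frac-≡ (1 ℕ.* (C ℕ.* suc n) ℕ.+ 1 ℕ.* d) (d ℕ.* (C ℕ.* suc n)) 1 (C ℕ.* n) (identity C n) ⟩
  + 1 / (C ℕ.* n) ∎
  where
  open ℚ.≤-Reasoning
  d = C ℕ.* (n ℕ.* suc n)
  instance
    n[n+1]≢0 : NonZero (n ℕ.* suc n)
    n[n+1]≢0 = ℕ.m*n≢0 n (suc n)
    d≢0 : NonZero d
    d≢0 = ℕ.m*n≢0 C (n ℕ.* suc n)
    _ = ℕ.m*n≢0 d (C ℕ.* suc n)
  identity : ∀ C n → (1 ℕ.* (C ℕ.* suc n) ℕ.+ 1 ℕ.* (C ℕ.* (n ℕ.* suc n))) ℕ.* (C ℕ.* n) ≡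
                     1 ℕ.* (C ℕ.* (n ℕ.* suc n) ℕ.* (C ℕ.* suc n))
  identity = solve-∀

-- The integral combination `Δ` and its polynomial weight.

module Combination (a : ℕ) .{{_ : NonZero a}} where

  -- With x^k replaced by f k, this is the value of x^j ∏_{i=1}^{M} (1 - i^a x).
  Δ : ℕ → (ℕ → ℚ) → ℕ → ℚ
  Δ zero    f j = f j
  Δ (suc M) f j = Δ M f j - (+ (suc M ℕ.^ a) / 1) * Δ M f (suc j)

  -- The polynomial `w` of the opening comment, evaluated at `u`.
  weight : ℕ → ℚ → ℚ
  weight zero    u = 1ℚ
  weight (suc M) u = weight M u * (1ℚ - (+ (suc M ℕ.^ a) / 1) * u)

  Δ-0 : ∀ M j → Δ M (λ _ → 0ℚ) j ≡ 0ℚ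
  Δ-0 zero    j = refl
  Δ-0 (suc M) j rewrite Δ-0 M j | Δ-0 M (suc j) =
    solve 1 (λ c → con 0ℚ :- c :* con 0ℚ := con 0ℚ) refl (+ (suc M ℕ.^ a) / 1)

  Δ-+ : ∀ M f g j → Δ M (λ k → f k + g k) j ≡ Δ M f j + Δ M g j
  Δ-+ zero    f g j = refl
  Δ-+ (suc M) f g j rewrite Δ-+ M f g j | Δ-+ M f g (suc j) =
    solve 5 (λ p q c r s → (p :+ q) :- c :* (r :+ s) := (p :- c :* r) :+ (q :- c :* s)) refl
      (Δ M f j) (Δ M g j) (+ (suc M ℕ.^ a) / 1) (Δ M f (suc j)) (Δ M g (suc j))

  -- On a geometric sequence of ratio `u` the shift of the index is multiplication by `u`, so each
  -- step of `Δ` contributes the factor `1 - i^a u`. It is applied to `k ↦ m^(-s k)` with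
  -- `u = m^(-a)`.
  Δ-geometric : ∀ M f u → (∀ k → f (suc k) ≡ u * f k) → ∀ j → Δ M f j ≡ weight M u * f j
  Δ-geometric zero    f u h j = sym (ℚ.*-identityˡ (f j))
  Δ-geometric (suc M) f u h j rewrite Δ-geometric M f u h j | Δ-geometric M f u h (suc j) | h j =
    solve 4 (λ w f c u → w :* f :- c :* (w :* (u :* f)) := (w :* (con 1ℚ :- c :* u)) :* f) refl
      (weight M u) (f j) (+ (suc M ℕ.^ a) / 1) u

  Δ-converges : ∀ {F : ℕ → ℕ → ℚ} {f} → (∀ k → Converges (λ N → F N k) (f k)) →
                ∀ M j → Converges (λ N → Δ M (F N) j) (Δ M f j)
  Δ-converges h zero    j = h j
  Δ-converges {F} {f} h (suc M) j =
    converges-sub-scaled {λ N → Δ M (F N) j} {λ N → Δ M (F N) (suc j)} {Δ M f j} {Δ M f (suc j)}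
      (+ (suc M ℕ.^ a) / 1) (Δ-converges {F} {f} h M j) (Δ-converges {F} {f} h M (suc j))

  -- `Δ M f j` is a combination of `f j`, ..., `f (M + j)` with integer coefficients.
  Δ-isInteger : ∀ {f} Q M j → (∀ k → k ℕ.≤ M ℕ.+ j → IsInteger (Q * f k)) → IsInteger (Q * Δ M f j)
  Δ-isInteger Q zero    j h = h j ℕ.≤-refl
  Δ-isInteger {f} Q (suc M) j h = subst IsInteger
    (solve 4 (λ Q x c y → Q :* x :- c :* (Q :* y) := Q :* (x :- c :* y)) refl
       Q (Δ M f j) (+ (suc M ℕ.^ a) / 1) (Δ M f (suc j)))
    (isInteger-sub-scaled (suc M ℕ.^ a)
      (Δ-isInteger Q M j λ k k≤ → h k (ℕ.m≤n⇒m≤1+n k≤))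
      (Δ-isInteger Q M (suc j) λ k k≤ → h k (subst (k ℕ.≤_) (ℕ.+-suc M j) k≤)))

  private
    ratio : ∀ i m .{{_ : NonZero m}} →
            (+ (i ℕ.^ a) / 1) * 1/ m ^ a ≡ (+ (i ℕ.^ a) / (m ℕ.^ a)) {{ℕ.m^n≢0 m a}}
    ratio i m = trans (frac-* (i ℕ.^ a) 1 1 (m ℕ.^ a))
      (frac-≡ (i ℕ.^ a ℕ.* 1) (1 ℕ.* m ℕ.^ a) (i ℕ.^ a) (m ℕ.^ a) (identity (i ℕ.^ a) (m ℕ.^ a)))
      where
      instance
        m^a≢0 : NonZero (m ℕ.^ a)
        m^a≢0 = ℕ.m^n≢0 m a
        _ = ℕ.m*n≢0 1 (m ℕ.^ a)
      identity : ∀ x y → x ℕ.* 1 ℕ.* y ≡ x ℕ.* (1 ℕ.* y)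
      identity = solve-∀

  -- The product contains the factor with `i = m`, which is `1 - m^a m^(-a) = 0`.
  weight-vanishes : ∀ {m M} .{{_ : NonZero m}} → m ℕ.≤′ M → weight M (1/ m ^ a) ≡ 0ℚ
  weight-vanishes {m@(suc M)} ℕ.≤′-refl = begin
    weight M u * (1ℚ - (+ (m ℕ.^ a) / 1) * u)  ≡⟨ cong (λ z → weight M u * (1ℚ - z)) ratio≡1 ⟩
    weight M u * 0ℚ                            ≡⟨ ℚ.*-zeroʳ (weight M u) ⟩
    0ℚ                                         ∎
    where
    open ≡-Reasoning
    u = 1/ m ^ a
    instance
      m^a≢0 : NonZero (m ℕ.^ a)
      m^a≢0 = ℕ.m^n≢0 m a
    ratio≡1 : (+ (m ℕ.^ a) / 1) * u ≡ 1ℚ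
    ratio≡1 = trans (ratio m m) (frac-≡ (m ℕ.^ a) (m ℕ.^ a) 1 1 (ℕ.*-comm (m ℕ.^ a) 1))
  weight-vanishes {m} (ℕ.≤′-step {M} m≤M) =
    trans (cong (_* (1ℚ - (+ (suc M ℕ.^ a) / 1) * 1/ m ^ a)) (weight-vanishes m≤M))
          (ℚ.*-zeroˡ (1ℚ - (+ (suc M ℕ.^ a) / 1) * 1/ m ^ a))

  private
    factor-pos : ∀ i m .{{_ : NonZero m}} → i ℕ.< m → 0ℚ < 1ℚ - (+ (i ℕ.^ a) / 1) * 1/ m ^ a
    factor-pos i m i<m = p<q⇒0<q-p (subst (_< 1ℚ) (sym (ratio i m))
      (frac-mono-< (i ℕ.^ a) (m ℕ.^ a) 1 1
        (subst₂ ℕ._<_ (sym (ℕ.*-identityʳ (i ℕ.^ a))) (sym (ℕ.*-identityˡ (m ℕ.^ a)))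
          (ℕ.^-monoˡ-< a i<m))))
      where
      instance
        m^a≢0 : NonZero (m ℕ.^ a)
        m^a≢0 = ℕ.m^n≢0 m a

    factor≤1 : ∀ i m .{{_ : NonZero m}} → 1ℚ - (+ (i ℕ.^ a) / 1) * 1/ m ^ a ≤ 1ℚ
    factor≤1 i m = ℚ.+-monoʳ-≤ 1ℚ (ℚ.neg-antimono-≤ (subst (0ℚ ≤_) (sym (ratio i m))
      (frac-nonNeg (i ℕ.^ a) (m ℕ.^ a) {{ℕ.m^n≢0 m a}})))

  -- For `i ≤ M < m` every factor `1 - (i/m)^a` is positive, as `a` is at least 1.
  weight-pos : ∀ M m .{{_ : NonZero m}} → M ℕ.< m → 0ℚ < weight M (1/ m ^ a)
  weight-pos zero    m M<m = ℚ.positive⁻¹ 1ℚ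
  weight-pos (suc M) m M<m = ℚ.positive⁻¹ _ {{ℚ.pos*pos⇒pos
    (weight M (1/ m ^ a)) {{ℚ.positive (weight-pos M m (ℕ.<-trans (ℕ.n<1+n M) M<m))}}
    (1ℚ - (+ (suc M ℕ.^ a) / 1) * 1/ m ^ a) {{ℚ.positive (factor-pos (suc M) m M<m)}}}}

  weight≤1 : ∀ M m .{{_ : NonZero m}} → M ℕ.< m → weight M (1/ m ^ a) ≤ 1ℚ
  weight≤1 zero    m M<m = ℚ.≤-refl
  weight≤1 (suc M) m M<m = begin
    weight M u * x  ≤⟨ ℚ.*-monoʳ-≤-nonNeg x {{ℚ.nonNegative (ℚ.<⇒≤ (factor-pos (suc M) m M<m))}}
                         (weight≤1 M m (ℕ.<-trans (ℕ.n<1+n M) M<m)) ⟩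
    1ℚ * x          ≡⟨ ℚ.*-identityˡ x ⟩
    x               ≤⟨ factor≤1 (suc M) m ⟩
    1ℚ              ∎
    where
    open ℚ.≤-Reasoning
    u = 1/ m ^ a
    x = 1ℚ - (+ (suc M ℕ.^ a) / 1) * u

  -- The combination applied to partial sums of Dirichlet series.

  module DirichletSeries (s : ℕ → ℕ) (s-suc : ∀ k → s (suc k) ≡ a ℕ.+ s k)
                         (s-lower : ∀ j → 2 ℕ.+ j ℕ.≤ s j) where

    D : ℕ → ℕ → ℕ → ℚ
    D M j N = Δ M (λ k → partialSum (s k) N) j

    -- The exponents `s k` increase by `a`, so the newly added terms form a geometric sequence in
    -- `k` of ratio `(N+1)^(-a)`, and additivity of `Δ` splits them off.
    D-suc : ∀ M j N → D M j (suc N) ≡ D M j N + weight M (1/ suc N ^ a) * 1/ suc N ^ s j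
    D-suc M j N = trans (Δ-+ M (λ k → partialSum (s k) N) (λ k → 1/ suc N ^ s k) j)
      (cong (λ z → D M j N + z) (Δ-geometric M (λ k → 1/ suc N ^ s k) (1/ suc N ^ a)
        (λ k → trans (cong (1/ suc N ^_) (s-suc k)) (1/^-+ (suc N) a (s k))) j))

    D-vanishes : ∀ M j N → N ℕ.≤ M → D M j N ≡ 0ℚ
    D-vanishes M j zero    N≤M = Δ-0 M j
    D-vanishes M j (suc N) N≤M = begin
      D M j (suc N)                                        ≡⟨ D-suc M j N ⟩
      D M j N + weight M (1/ suc N ^ a) * 1/ suc N ^ s j
        ≡⟨ cong₂ (λ x y → x + y * 1/ suc N ^ s j) (D-vanishes M j N (ℕ.<⇒≤ N≤M))
             (weight-vanishes (ℕ.≤⇒≤′ N≤M)) ⟩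
      0ℚ + 0ℚ * 1/ suc N ^ s j
        ≡⟨ solve 1 (λ x → con 0ℚ :+ con 0ℚ :* x := con 0ℚ) refl (1/ suc N ^ s j) ⟩
      0ℚ ∎
      where open ≡-Reasoning

    private
      term-pos : ∀ M j N → M ℕ.≤ N → 0ℚ < weight M (1/ suc N ^ a) * 1/ suc N ^ s j
      term-pos M j N M≤N = ℚ.positive⁻¹ _ {{ℚ.pos*pos⇒pos
        (weight M (1/ suc N ^ a)) {{ℚ.positive (weight-pos M (suc N) (s≤s M≤N))}}
        (1/ suc N ^ s j) {{1/^-pos (suc N) (s j)}}}}

    -- The term `m = M + 1` is the first to survive and is positive.
    D-pos : ∀ M j → 0ℚ < D M j (suc M)
    D-pos M j = begin-strict
      0ℚ                                                  <⟨ term-pos M j M ℕ.≤-refl ⟩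
      weight M (1/ suc M ^ a) * 1/ suc M ^ s j            ≡⟨ ℚ.+-identityˡ _ ⟨
      0ℚ + weight M (1/ suc M ^ a) * 1/ suc M ^ s j
        ≡⟨ cong (_+ weight M (1/ suc M ^ a) * 1/ suc M ^ s j) (D-vanishes M j M ℕ.≤-refl) ⟨
      D M j M + weight M (1/ suc M ^ a) * 1/ suc M ^ s j  ≡⟨ D-suc M j M ⟨
      D M j (suc M)                                       ∎
      where open ℚ.≤-Reasoning

    D-mono : ∀ M j {N} → M ℕ.≤′ N → D M j (suc M) ≤ D M j (suc N)
    D-mono M j ℕ.≤′-refl = ℚ.≤-refl
    D-mono M j (ℕ.≤′-step {N} M≤N) = begin
      D M j (suc M)         ≤⟨ D-mono M j M≤N ⟩
      D M j (suc N)         ≡⟨ ℚ.+-identityʳ _ ⟨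
      D M j (suc N) + 0ℚ    ≤⟨ ℚ.+-monoʳ-≤ (D M j (suc N))
                                 (ℚ.<⇒≤ (term-pos M j (suc N) (ℕ.m≤n⇒m≤1+n (ℕ.≤′⇒≤ M≤N)))) ⟩
      D M j (suc N) + weight M (1/ suc (suc N) ^ a) * 1/ suc (suc N) ^ s j
                            ≡⟨ D-suc M j (suc N) ⟨
      D M j (suc (suc N))   ∎
      where open ℚ.≤-Reasoning

    -- Upper bound for the combination and lower bound for denominators.

    module _ (M j : ℕ) .{{_ : NonZero M}} where
      private
        C = suc M ℕ.^ j

        C*n≢0 : ∀ n → .{{NonZero n}} → NonZero (C ℕ.* n)
        C*n≢0 n = ℕ.m*n≢0 C n {{ℕ.m^n≢0 (suc M) j}}

        -- A majorant of the tail over all `m > n`, for `n ≥ M`.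
        bound : ∀ n → .{{NonZero n}} → ℚ
        bound n = (+ 1 / (C ℕ.* n)) {{C*n≢0 n}}

        -- Of the exponent `s j ≥ j + 2`, the part `j` pays for `C = (M+1)^j` and the remaining
        -- square makes the reciprocals telescope.
        power-bound : ∀ {n} → M ℕ.≤ n → C ℕ.* (n ℕ.* suc n) ℕ.≤ suc n ℕ.^ s j
        power-bound {n} M≤n = begin
          C ℕ.* (n ℕ.* suc n)
            ≤⟨ ℕ.*-mono-≤ (ℕ.^-monoˡ-≤ j (s≤s M≤n)) (ℕ.*-monoˡ-≤ (suc n) (ℕ.n≤1+n n)) ⟩
          suc n ℕ.^ j ℕ.* (suc n ℕ.* suc n)
            ≡⟨ rearrange (suc n ℕ.^ j) (suc n) ⟩
          suc n ℕ.^ (2 ℕ.+ j)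
            ≤⟨ ℕ.^-monoʳ-≤ (suc n) (s-lower j) ⟩
          suc n ℕ.^ s j ∎
          where
          open ℕ.≤-Reasoning
          rearrange : ∀ x y → x ℕ.* (y ℕ.* y) ≡ y ℕ.* (y ℕ.* x)
          rearrange = solve-∀

        -- The left side does not increase with `N`: each new term is paid for by the drop from
        -- `bound N` to `bound (suc N)`. At `N = M` it equals `bound M`, since `D` vanishes there.
        D-bound : ∀ {N} .{{_ : NonZero N}} → M ℕ.≤′ N → D M j N + bound N ≤ bound M
        D-bound ℕ.≤′-refl = ℚ.≤-reflexive
          (trans (cong (_+ bound M) (D-vanishes M j M ℕ.≤-refl)) (ℚ.+-identityˡ (bound M)))
        D-bound (ℕ.≤′-step {N} M≤N) = begin
          D M j (suc N) + bound (suc N)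
            ≡⟨ cong (_+ bound (suc N)) (D-suc M j N) ⟩
          (D M j N + w * t) + bound (suc N)
            ≡⟨ ℚ.+-assoc (D M j N) (w * t) (bound (suc N)) ⟩
          D M j N + (w * t + bound (suc N))
            ≤⟨ ℚ.+-monoʳ-≤ (D M j N) (ℚ.+-monoˡ-≤ (bound (suc N))
                 (ℚ.*-monoʳ-≤-nonNeg t {{ℚ.pos⇒nonNeg t {{1/^-pos (suc N) (s j)}}}}
                   (weight≤1 M (suc N) (s≤s (ℕ.≤′⇒≤ M≤N))))) ⟩
          D M j N + (1ℚ * t + bound (suc N))
            ≡⟨ cong (λ z → D M j N + (z + bound (suc N))) (ℚ.*-identityˡ t) ⟩
          D M j N + (t + bound (suc N))
            ≤⟨ ℚ.+-monoʳ-≤ (D M j N) (telescoping-step C N (suc N ℕ.^ s j)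
                 {{ℕ.m^n≢0 (suc M) j}} {{N≢0}} {{ℕ.m^n≢0 (suc N) (s j)}} {{C*n≢0 (suc N)}} {{C*n≢0 N}}
                 (power-bound (ℕ.≤′⇒≤ M≤N))) ⟩
          D M j N + bound N
            ≤⟨ D-bound M≤N ⟩
          bound M ∎
          where
          open ℚ.≤-Reasoning
          instance
            N≢0 : NonZero N
            N≢0 = ℕ.>-nonZero (ℕ.≤-trans (ℕ.>-nonZero⁻¹ M) (ℕ.≤′⇒≤ M≤N))
          w = weight M (1/ suc N ^ a)
          t = 1/ suc N ^ s j

      D-upper : ∀ {N} → M ℕ.≤ N → D M j (suc N) ≤ bound M
      D-upper {N} M≤N = ℚ.≤-trans
        (p≤p+frac (D M j (suc N)) 1 (C ℕ.* suc N) {{C*n≢0 (suc N)}})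
        (D-bound (ℕ.≤⇒≤′ (ℕ.m≤n⇒m≤1+n M≤N)))

      -- The number `q * Δ M f j` is a positive integer and at most `q / (C * M)`, so
      -- `C ≤ C * M ≤ q`.
      denominator-bound : ∀ f → (∀ k → Converges (λ N → partialSum (s k) (suc N)) (f k)) →
                          ∀ q .{{_ : NonZero q}} →
                          (∀ k → k ℕ.≤ M ℕ.+ j → IsInteger ((+ q / 1) * f k)) →
                          suc M ℕ.^ j ℕ.≤ q
      denominator-bound f conv q integral = ℕ.≤-trans (ℕ.m≤m*n C M)
        (frac-cancel-1≤ q (C ℕ.* M) {{C*n≢0 M}} (begin
          1ℚ
            ≤⟨ positive-integer-≥1 (Δ-isInteger (+ q / 1) M j integral)
                 (ℚ.positive⁻¹ _ {{ℚ.pos*pos⇒pos (+ q / 1) {{ℚ.normalize-pos q 1}}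
                                     (Δ M f j) {{ℚ.positive Δ-pos}}}}) ⟩
          (+ q / 1) * Δ M f j
            ≤⟨ ℚ.*-monoˡ-≤-nonNeg (+ q / 1) {{ℚ.normalize-nonNeg q 1}} Δ≤ ⟩
          (+ q / 1) * bound M
            ≡⟨ frac-* q 1 1 (C ℕ.* M) {{_}} {{C*n≢0 M}} {{ℕ.m*n≢0 1 (C ℕ.* M) {{_}} {{C*n≢0 M}}}} ⟩
          (+ (q ℕ.* 1) / (1 ℕ.* (C ℕ.* M))) {{ℕ.m*n≢0 1 (C ℕ.* M) {{_}} {{C*n≢0 M}}}}
            ≡⟨ frac-≡ (q ℕ.* 1) (1 ℕ.* (C ℕ.* M)) q (C ℕ.* M)
                 {{ℕ.m*n≢0 1 (C ℕ.* M) {{_}} {{C*n≢0 M}}}} {{C*n≢0 M}} (identity q (C ℕ.* M)) ⟩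
          (+ q / (C ℕ.* M)) {{C*n≢0 M}} ∎))
        where
        open ℚ.≤-Reasoning
        limit : Converges (λ N → D M j (suc N)) (Δ M f j)
        limit = Δ-converges conv M j
        Δ-pos : 0ℚ < Δ M f j
        -- Strict positivity need not survive a limit, so the limit is compared with the fixed
        -- positive value `D M j (suc M)`.
        Δ-pos = ℚ.<-≤-trans (D-pos M j)
          (converges-lower M limit λ N M≤N → D-mono M j (ℕ.≤⇒≤′ M≤N))
        Δ≤ : Δ M f j ≤ bound M
        Δ≤ = converges-upper M limit λ N M≤N → D-upper M≤N
        identity : ∀ x y → x ℕ.* 1 ℕ.* y ≡ x ℕ.* (1 ℕ.* y)
        identity = solve-∀

-- The dichotomy and the growth of common denominators.

module _ (a b : ℕ) .{{_ : NonZero a}} .{{_ : NonZero b}} where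

  EventuallyRational : Set
  EventuallyRational =
    ∃[ N ] (∀ n (n≢0 : NonZero n) → N ℕ.≤ n → ∃[ r ] ζ[ak+b] a b n {{k≢0 = n≢0}} ≈ℝ fromℚ r)

  -- If eventual rationality fails, then beyond each `N` there is an irrational value: otherwise
  -- excluded middle, applied to each single value, would make all values from `N` on rational.
  infinitelyManyIrrational⊎eventuallyRational :
    ExcludedMiddle 0ℓ → InfinitelyManyIrrational a b ⊎ EventuallyRational
  infinitelyManyIrrational⊎eventuallyRational em with em {EventuallyRational}
  ... | yes rational   = inj₂ rational
  ... | no  ¬rational = inj₁ irrational
    where
    irrational : InfinitelyManyIrrational a b
    irrational N
      with em {∃[ n ] Σ[ n≢0 ∈ NonZero n ] N ℕ.≤ n × Irrational (ζ[ak+b] a b n {{k≢0 = n≢0}})}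
    ... | yes found  = found
    ... | no  ¬found = contradiction (N , rational) ¬rational
      where
      rational : ∀ n (n≢0 : NonZero n) → N ℕ.≤ n → ∃[ r ] ζ[ak+b] a b n {{k≢0 = n≢0}} ≈ℝ fromℚ r
      rational n n≢0 N≤n with em {∃[ r ] ζ[ak+b] a b n {{k≢0 = n≢0}} ≈ℝ fromℚ r}
      ... | yes found′ = found′
      ... | no  irr    = contradiction (n , n≢0 , N≤n , irr) ¬found

  module _ (N₀ : ℕ)
           (rational : ∀ n (n≢0 : NonZero n) → N₀ ℕ.≤ n → ∃[ r ] ζ[ak+b] a b n {{k≢0 = n≢0}} ≈ℝ fromℚ r)
           where
    private
      -- Starting at index `suc N₀` makes every index positive and every value rational.
      s : ℕ → ℕ
      s k = a ℕ.* (suc N₀ ℕ.+ k) ℕ.+ b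

      s-suc : ∀ k → s (suc k) ≡ a ℕ.+ s k
      s-suc = identity a b N₀
        where
        identity : ∀ a b N k → a ℕ.* (suc N ℕ.+ suc k) ℕ.+ b ≡ a ℕ.+ (a ℕ.* (suc N ℕ.+ k) ℕ.+ b)
        identity = solve-∀

      s-lower : ∀ j → 2 ℕ.+ j ℕ.≤ s j
      s-lower j = begin
        2 ℕ.+ j                       ≡⟨ ℕ.+-comm 1 (suc j) ⟩
        suc j ℕ.+ 1                   ≤⟨ ℕ.+-mono-≤ (s≤s (ℕ.m≤n+m j N₀)) (ℕ.>-nonZero⁻¹ b) ⟩
        suc N₀ ℕ.+ j ℕ.+ b            ≤⟨ ℕ.+-monoˡ-≤ b (ℕ.m≤n*m (suc N₀ ℕ.+ j) a) ⟩
        s j                           ∎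
        where open ℕ.≤-Reasoning

      value : ∀ k → ∃[ r ] ζ[ak+b] a b (suc N₀ ℕ.+ k) ≈ℝ fromℚ r
      value k = rational (suc N₀ ℕ.+ k) _ (ℕ.m≤n⇒m≤1+n (ℕ.m≤m+n N₀ k))

      f : ℕ → ℚ
      f k = proj₁ (value k)

      converges : ∀ k → Converges (λ N → partialSum (s k) (suc N)) (f k)
      -- The rate 2 is the one built into `_≈ℝ_`.
      converges k = + 2 / 1 , λ N → ℚ.≤-trans (proj₂ (value k) N) (ℚ.≤-reflexive (sym
        (trans (frac-* 2 1 1 (suc N))
               (frac-≡ 2 (1 ℕ.* suc N) 2 (suc N) (cong (2 ℕ.*_) (sym (ℕ.*-identityˡ (suc N))))))))

    commonDenominator-lower : ∀ M j .{{_ : NonZero M}} q →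
      IsCommonDenominator a b (suc N₀ ℕ.+ (M ℕ.+ j)) q → suc M ℕ.^ j ℕ.≤ q
    commonDenominator-lower M j q (q≢0 , integral) =
      denominator-bound M j f converges q {{q≢0}} λ k k≤M+j →
        integral (suc N₀ ℕ.+ k) (ℕ.+-monoʳ-≤ (suc N₀) k≤M+j) (f k) (proj₂ (value k))
      where open Combination.DirichletSeries a s s-suc s-lower

    -- Taking `M + 1 = c^2` doubles the exponent: writing `n = T + j`, the condition `n ≥ 2T` gives
    -- `n ≤ 2j`, hence `c^n ≤ (c^2)^j ≤ q`. The loss of `T` indices is thereby absorbed.
    commonDenominator-^-lower : ∀ c → 2 ℕ.≤ c →
      ∃[ N ] (∀ n q → N ℕ.≤ n → IsCommonDenominator a b n q → c ℕ.^ n ℕ.≤ q)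
    commonDenominator-^-lower c@(suc (suc _)) (s≤s (s≤s z≤n)) = T ℕ.+ T , λ n q T+T≤n isCommon →
      let
        j = n ℕ.∸ T
        T≤n = ℕ.≤-trans (ℕ.m≤m+n T T) T+T≤n
        n≡T+j = sym (ℕ.m+[n∸m]≡n T≤n)
        n≡ = trans n≡T+j (ℕ.+-assoc (suc N₀) M j)
        T≤j = ℕ.m+n≤o⇒m≤o∸n T T+T≤n
      in begin
        c ℕ.^ n                   ≤⟨ ℕ.^-monoʳ-≤ c (ℕ.≤-trans (ℕ.≤-reflexive n≡T+j) (ℕ.+-monoˡ-≤ j T≤j)) ⟩
        c ℕ.^ (j ℕ.+ j)           ≡⟨ cong (λ e → c ℕ.^ (j ℕ.+ e)) (ℕ.+-identityʳ j) ⟨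
        c ℕ.^ (2 ℕ.* j)           ≡⟨ ℕ.^-*-assoc c 2 j ⟨
        (c ℕ.^ 2) ℕ.^ j           ≡⟨ cong (λ e → (c ℕ.* e) ℕ.^ j) (ℕ.*-identityʳ c) ⟩
        suc M ℕ.^ j               ≤⟨ commonDenominator-lower M j q
                                       (subst (λ m → IsCommonDenominator a b m q) n≡ isCommon) ⟩
        q                         ∎
      where
      open ℕ.≤-Reasoning
      -- Since `c` is at least 2, this `M` is positive.
      M = ℕ.pred (c ℕ.* c)
      T = suc N₀ ℕ.+ M

-- From denominators to their roots, and the conclusion.

<root : ∀ (x : ℝ) c → seq x 0 + + 2 / 1 < + c / 1 → ∀ n .{{_ : NonZero n}} q → c ℕ.^ n ℕ.≤ q →
        x <ℝ root n q
-- At index 0 the approximation of the root is the integer `ρ` and the slack in `_<ℝ_` is 2, which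
-- `x<c` already includes.
<root x c x<c n q c^n≤q = 0 , ℚ.<-≤-trans x<c (frac-mono c 1 ρ 1 (ℕ.*-monoˡ-≤ 1 c≤ρ))
  where
  ρ = ⌊root⌋ n (q ℕ.* 1 ℕ.^ n)
  c^n<[1+ρ]^n : c ℕ.^ n ℕ.< suc ρ ℕ.^ n
  c^n<[1+ρ]^n = ℕ.≤-<-trans
    (ℕ.≤-trans c^n≤q (ℕ.m≤m*n q (1 ℕ.^ n) {{ℕ.m^n≢0 1 n}}))
    (⌊root⌋-upper n (q ℕ.* 1 ℕ.^ n))
  c≤ρ : c ℕ.≤ ρ
  c≤ρ with c ℕ.≤? ρ
  ... | yes p = p
  ... | no  p = contradiction (ℕ.^-monoˡ-≤ n (ℕ.≰⇒> p)) (ℕ.<⇒≱ c^n<[1+ρ]^n)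

theorem1 : ExcludedMiddle 0ℓ →
    (a b : ℕ) .{{_ : NonZero a}} .{{_ : NonZero b}} →
    (q : ℕ → ℕ) →
    (∀ n .{{_ : NonZero n}} → IsLeastCommonDenominator a b n (q n)) →
    InfinitelyManyIrrational a b ⊎ GrowsSuperExponentially q
theorem1 em a b q least with infinitelyManyIrrational⊎eventuallyRational a b em
... | inj₁ irrational = inj₁ irrational
... | inj₂ (N₀ , rational) = inj₂ λ x →
  let
    m , x<m = <-natural (seq x 0 + + 2 / 1)
    -- Adding 2 keeps `c` above `seq x 0 + 2` and secures `2 ≤ c`.
    c = 2 ℕ.+ m
    x<c = ℚ.<-≤-trans x<m (frac-mono m 1 c 1 (ℕ.*-monoˡ-≤ 1 (ℕ.m≤n+m m 2)))
    N , lower = commonDenominator-^-lower a b N₀ rational c (s≤s (s≤s z≤n))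
  in N , λ n N≤n → <root x c x<c n (q n) (lower n (q n) N≤n (proj₁ (least n)))
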